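{- Let $r\ge 3$ be an integer and let $k$ be a positive integer. Then $\mathrm{COV}(r,k)=k$.
   Context: A complete $r$-uniform $r$-partite hypergraph $K$ has a vertex set $V=V(K)$ partitioned into nonempty classes $V_1\cup\dots\cup V_r$, and its edges are exactly the sets containing one vertex from each class. A $k$-coloring of a hypergraph is an assignment of a color from $[k]=\{1,\dots,k\}$ to each edge (not all $k$ colors need be used). For an edge-colored hypergraph $H$, let $H_i$ be the subhypergraph on vertex set $V(H)$ consisting of the edges of color $i$. A hypergraph is connected if it has only one vertex or any two distinct vertices can be connected by a sequence of edges each intersecting the next; every hypergraph is uniquely partitioned into connected components (a component may be a single vertex). A monochromatic component of $H$ is (the vertex set of) a connected component of $H_i$ for some color $i$. Let $c(H)$ be the minimum integer $m$ such that $V(H)$ can be covered by $m$ monochromatic components of $H$. $\mathrm{COV}(r,k)$ is the maximum of $c(K)$ when $K$ ranges over all (not necessarily spanning, i.e. arbitrary) $k$-colorings of complete $r$-uniform $r$-partite hypergraphs. -}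

module Defs where

open import Axiom.UniquenessOfIdentityProofs using (module Decidable⇒UIP)
open import Data.Fin using (Fin)
import Data.Fin.Properties as Fin
open import Data.List using (List; []; _∷_; concatMap; map; cartesianProductWith; allFin)
open import Data.List.Membership.Propositional as L using (lose; find)
open import Data.List.Membership.Propositional.Properties
  using (∈-map⁺; ∈-concatMap⁺; ∈-allFin; ∈-cartesianProductWith⁺)
open import Data.List.Relation.Unary.Any as LAny using (here; there)
import Data.List.Relation.Unary.All as LAll
open import Data.Nat using (ℕ; zero; suc; NonZero; _≤_; z≤n; s≤s)
open import Data.Product using (Σ; ∃; _×_; _,_; proj₁; proj₂)
open import Data.Product.Properties using (≡-dec)
open import Data.Sum using (_⊎_; inj₁; inj₂)
open import Data.Vec as Vec using (Vec; []; _∷_)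
open import Data.Vec.Relation.Unary.All using (All; []; _∷_)
open import Data.Vec.Relation.Unary.All.Properties using (lookup⁺)
open import Data.Vec.Relation.Unary.Any using (Any; any?)
open import Data.Vec.Relation.Unary.Any.Properties using (fromList⁺)
open import Level using (0ℓ)
open import Relation.Binary using (Rel; DecidableEquality)
import Relation.Binary as B
open import Relation.Binary.Construct.Closure.ReflexiveTransitive using (Star; ε; _◅_; _◅◅_)
open import Relation.Binary.PropositionalEquality using (_≡_; refl)
open import Relation.Nullary using (Dec; yes; no; contradiction)
open import Relation.Nullary.Decidable using (map′; _×-dec_; _⊎-dec_)
open import Relation.Unary using (Pred; Decidable)

record Enumeration (A : Set) : Set where
  field
    elements : List A
    complete : ∀ a → a L.∈ elements

open Enumeration

∃? : ∀ {A : Set} {P : A → Set} → Enumeration A → Decidable P → Dec (∃ P)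
∃? en P? = map′ (λ h → let (a , _ , p) = find h in a , p)
                (λ (a , p) → lose (complete en a) p)
                (LAny.any? P? (elements en))

∀? : ∀ {A : Set} {P : A → Set} → Enumeration A → Decidable P → Dec (∀ a → P a)
∀? en P? = map′ (λ h a → LAll.lookup h (complete en a))
                (λ h → LAll.universal h (elements en))
                (LAll.all? P? (elements en))

Fin-enum : ∀ n → Enumeration (Fin n)
Fin-enum n = record { elements = allFin n ; complete = ∈-allFin }

≡-enum : ∀ {n} (i j : Fin n) → Enumeration (i ≡ j)
≡-enum i j with i Fin.≟ j
... | yes p = record { elements = p ∷ [] ; complete = λ q → here (Decidable⇒UIP.≡-irrelevant Fin._≟_ q p) }
... | no ¬p = record { elements = [] ; complete = λ q → contradiction q ¬p }

Σ-enum : ∀ {A : Set} {B : A → Set} →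
         Enumeration A → (∀ a → Enumeration (B a)) → Enumeration (Σ A B)
Σ-enum as bs = record
  { elements = concatMap (λ a → map (a ,_) (elements (bs a))) (elements as)
  ; complete = λ (a , b) →
      ∈-concatMap⁺ _ (lose (complete as a) (∈-map⁺ (a ,_) (complete (bs a) b)))
  }

All-enum : ∀ {A : Set} {P : A → Set} {n} (xs : Vec A n) →
           (∀ a → Enumeration (P a)) → Enumeration (All P xs)
All-enum []       ps = record { elements = [] ∷ [] ; complete = λ { [] → here refl } }
All-enum (x ∷ xs) ps = record
  { elements = cartesianProductWith _∷_ (elements (ps x)) (elements (All-enum xs ps))
  ; complete = λ { (p ∷ q) → ∈-cartesianProductWith⁺ _∷_
                     (complete (ps x) p) (complete (All-enum xs ps) q) }
  }

Vec-enum : ∀ {A : Set} n → Enumeration A → Enumeration (Vec A n)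
Vec-enum zero    as = record { elements = [] ∷ [] ; complete = λ { [] → here refl } }
Vec-enum (suc n) as = record
  { elements = cartesianProductWith _∷_ (elements as) (elements (Vec-enum n as))
  ; complete = λ { (a ∷ v) → ∈-cartesianProductWith⁺ _∷_
                     (complete as a) (complete (Vec-enum n as) v) }
  }

-- Reachability along a decidable relation on a finite type is decidable:
-- Via zs x y says that y is reachable from x using only intermediate
-- points from zs.

module Reachability {A : Set} (_≟_ : DecidableEquality A)
                    {R : Rel A 0ℓ} (R? : B.Decidable R) where

  Via : List A → Rel A 0ℓ
  Via []       x y = x ≡ y ⊎ R x y
  Via (z ∷ zs) x y = Via zs x y ⊎ (Via zs x z × Via zs z y)

  via? : ∀ zs → B.Decidable (Via zs)
  via? []       x y = (x ≟ y) ⊎-dec R? x y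
  via? (z ∷ zs) x y = via? zs x y ⊎-dec (via? zs x z ×-dec via? zs z y)

  sound : ∀ zs {x y} → Via zs x y → Star R x y
  sound []       (inj₁ refl)    = ε
  sound []       (inj₂ r)       = r ◅ ε
  sound (z ∷ zs) (inj₁ p)       = sound zs p
  sound (z ∷ zs) (inj₂ (p , q)) = sound zs p ◅◅ sound zs q

  base : ∀ zs {x y} → x ≡ y ⊎ R x y → Via zs x y
  base []       p = p
  base (z ∷ zs) p = inj₁ (base zs p)

  join : ∀ {zs x y z} → z L.∈ zs → Via zs x z → Via zs z y → Via zs x y
  join (here refl) p q = inj₂ (to p , from q)
    where
    to : ∀ {zs x z} → Via (z ∷ zs) x z → Via zs x z
    to (inj₁ p)       = p
    to (inj₂ (p , _)) = p
    from : ∀ {zs y z} → Via (z ∷ zs) z y → Via zs z y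
    from (inj₁ q)       = q
    from (inj₂ (_ , q)) = q
  join (there z∈) (inj₁ p)        (inj₁ q)        = inj₁ (join z∈ p q)
  join (there z∈) (inj₁ p)        (inj₂ (q , q′)) = inj₂ (join z∈ p q , q′)
  join (there z∈) (inj₂ (p , p′)) (inj₁ q)        = inj₂ (p , join z∈ p′ q)
  join (there z∈) (inj₂ (p , p′)) (inj₂ (q , q′)) = inj₂ (p , q′)

  reachable? : Enumeration A → B.Decidable (Star R)
  reachable? en x y = map′ (sound zs) reached (via? zs x y)
    where
    zs = elements en
    reached : ∀ {x y} → Star R x y → Via zs x y
    reached ε       = base zs (inj₁ refl)
    reached (r ◅ s) = join (complete en _) (base zs (inj₂ r)) (reached s)

IsMinimum IsMaximum : Pred ℕ 0ℓ → ℕ → Set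
IsMinimum P m = P m × (∀ n → P n → m ≤ n)
IsMaximum P m = P m × (∀ n → P n → n ≤ m)

minimum : {P : Pred ℕ 0ℓ} → Decidable P → ∃ P → ∃ (IsMinimum P)
minimum P? (n , p) = search P? n p
  where
  search : {P : Pred ℕ 0ℓ} → Decidable P → ∀ n → P n → ∃ (IsMinimum P)
  search P? n p with P? 0
  search P? n       p | yes p₀ = 0 , p₀ , λ _ _ → z≤n
  search P? zero    p | no ¬p₀ = contradiction p ¬p₀
  search P? (suc n) p | no ¬p₀ with search (λ m → P? (suc m)) n p
  ... | m , pm , least = suc m , pm , λ
    { zero    p₀ → contradiction p₀ ¬p₀
    ; (suc l) pl → s≤s (least l pl)
    }

-- Edges are given as a type with an incidence relation.

record Hypergraph : Set₁ where
  infix 4 _∈_ _∈?_ _≟ⱽ_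
  field
    Vertex : Set
    Edge   : Set
    _∈_    : Vertex → Edge → Set

    vertices : Enumeration Vertex
    edges    : Enumeration Edge
    _≟ⱽ_     : DecidableEquality Vertex
    _≟ᴱ_     : DecidableEquality Edge
    _∈?_     : B.Decidable _∈_

  Intersects : Rel Edge 0ℓ
  Intersects e f = ∃ λ v → v ∈ e × v ∈ f

  -- The star is a sequence of edges from e to f, each intersecting the next.

  Connected : Rel Vertex 0ℓ
  Connected u v = u ≡ v ⊎ ∃ λ e → ∃ λ f → u ∈ e × Star Intersects e f × v ∈ f

  intersects? : B.Decidable Intersects
  intersects? e f = ∃? vertices λ v → (v ∈? e) ×-dec (v ∈? f)

  connected? : B.Decidable Connected
  connected? u v = (u ≟ⱽ v) ⊎-dec
    ∃? edges λ e → ∃? edges λ f →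
      (u ∈? e) ×-dec (reachable? edges e f ×-dec (v ∈? f))
    where open Reachability _≟ᴱ_ intersects?

open Hypergraph using (Vertex; Edge; Connected)

Coloring : Hypergraph → ℕ → Set
Coloring H k = Edge H → Fin k

-- H_i: all the vertices of H, and the edges of color i.

colorClass : (H : Hypergraph) {k : ℕ} → Coloring H k → Fin k → Hypergraph
colorClass H χ i = record
  { Vertex   = Vertex H
  ; Edge     = Σ (Edge H) λ e → χ e ≡ i
  ; _∈_      = λ v (e , _) → v ∈ e
  ; vertices = vertices
  ; edges    = Σ-enum edges λ e → ≡-enum (χ e) i
  ; _≟ⱽ_     = _≟ⱽ_
  ; _≟ᴱ_     = ≡-dec _≟ᴱ_ λ p q → yes (Decidable⇒UIP.≡-irrelevant Fin._≟_ p q)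
  ; _∈?_     = λ v (e , _) → v ∈? e
  }
  where open Hypergraph H using (_∈_; vertices; edges; _≟ⱽ_; _≟ᴱ_; _∈?_)

module _ (H : Hypergraph) {k : ℕ} (χ : Coloring H k) where

  -- (i , u) stands for the connected component of H_i that contains u.

  MonochromaticComponent : Set
  MonochromaticComponent = Fin k × Vertex H

  _∈ᶜ_ : Vertex H → MonochromaticComponent → Set
  v ∈ᶜ (i , u) = Connected (colorClass H χ i) u v

  -- Repetitions in Cs are harmless, as only the least m matters.

  CoverableBy : ℕ → Set
  CoverableBy m = ∃ λ (Cs : Vec MonochromaticComponent m) → ∀ v → Any (v ∈ᶜ_) Cs

  coverableBy? : Decidable CoverableBy
  coverableBy? m =
    ∃? (Vec-enum m (Σ-enum (Fin-enum k) λ _ → vertices)) λ Cs →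
    ∀? vertices λ v →
    any? (λ (i , u) → Hypergraph.connected? (colorClass H χ i) u v) Cs
    where open Hypergraph H using (vertices)

  coverable : .{{NonZero k}} → ∃ CoverableBy
  coverable = _ , Vec.fromList (map (i ,_) (elements vertices)) , λ v →
    fromList⁺ (LAny.map (λ { refl → inj₁ refl }) (∈-map⁺ (i ,_) (complete vertices v)))
    where
    open Hypergraph H using (vertices)
    someColor : ∀ k → .{{NonZero k}} → Fin k
    someColor (suc _) = Fin.zero
    i = someColor k

  minimumCover : .{{NonZero k}} → ∃ (IsMinimum CoverableBy)
  minimumCover = minimum coverableBy? coverable

  -- The least number of monochromatic components covering the vertices.

  c : .{{NonZero k}} → ℕ
  c = proj₁ minimumCover

-- The i-th class consists of the vertices (i , x); an edge selects one
-- vertex from each class.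

completePartite : {r : ℕ} → Vec ℕ r → Hypergraph
completePartite {r} sizes = record
  { Vertex   = Σ (Fin r) λ i → Fin (Vec.lookup sizes i)
  ; Edge     = All Fin sizes
  ; _∈_      = λ (i , x) e → lookup⁺ e i ≡ x
  ; vertices = Σ-enum (Fin-enum r) λ i → Fin-enum (Vec.lookup sizes i)
  ; edges    = All-enum sizes Fin-enum
  ; _≟ⱽ_     = ≡-dec Fin._≟_ Fin._≟_
  ; _≟ᴱ_     = All-≟
  ; _∈?_     = λ (i , x) e → lookup⁺ e i Fin.≟ x
  }
  where
  All-≟ : ∀ {n} {ns : Vec ℕ n} → DecidableEquality (All Fin ns)
  All-≟ []       []       = yes refl
  All-≟ (x ∷ xs) (y ∷ ys) =
    map′ (λ { (refl , refl) → refl }) (λ { refl → refl , refl })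
         ((x Fin.≟ y) ×-dec All-≟ xs ys)

-- COV r k as a relation: that the maximum is attained is part of the claim.
-- Classes are nonempty by All NonZero sizes.

COV≡ : (r k : ℕ) → .{{NonZero k}} → ℕ → Set
COV≡ r k = IsMaximum λ n →
  ∃ λ (sizes : Vec ℕ r) → All NonZero sizes ×
  ∃ λ (χ : Coloring (completePartite sizes) k) → c (completePartite sizes) χ ≡ n

-- Upper bound: in the complete partite hypergraph K fix one vertex in each of
-- three classes. For every color i for which two of these three vertices lie in
-- the same component of K_i, take that component (transitivity makes it
-- unambiguous). Any vertex v lies in an edge together with two of the three fixed
-- vertices outside its own class, and the component taken for the color of this
-- edge contains v.
--
-- Lower bound: let all classes have size k and color each edge by its vertex in
-- the first class. No monochromatic component contains two vertices of that class.

module Submission where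

open import Defs
open import Data.Fin using (Fin; zero; suc)
open import Data.Fin.Properties using (injective⇒≤)
open import Data.Nat using (ℕ; zero; suc; NonZero; _≤_; s≤s)
open import Data.Nat.Properties using (≤-antisym)
open import Data.Product using (_,_; proj₁; proj₂)
open import Data.Sum using (inj₁; inj₂)
open import Data.Vec as Vec using (Vec; []; _∷_; replicate)
open import Data.Vec.Relation.Unary.All as All using (All; []; _∷_)
open import Data.Vec.Relation.Unary.All.Properties using (lookup⁺)
open import Data.Vec.Relation.Unary.Any using (Any; index)
open import Data.Vec.Relation.Unary.Any.Properties using (lookup-index; tabulate⁺)
open import Function.Base using (const)
open import Relation.Binary.Construct.Closure.ReflexiveTransitive using (ε; _◅_; _◅◅_; reverse)
open import Relation.Binary.Definitions using (Symmetric; Transitive)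
open import Relation.Binary.PropositionalEquality using (_≡_; refl; sym; subst)
open import Relation.Nullary using (yes; no; contradiction)

module _ (H : Hypergraph) where
  open Hypergraph H

  commonEdge⇒Connected : ∀ {u v e} → u ∈ e → v ∈ e → Connected u v
  commonEdge⇒Connected u∈e v∈e = inj₂ (_ , _ , u∈e , ε , v∈e)

  Connected-sym : Symmetric Connected
  Connected-sym (inj₁ refl) = inj₁ refl
  Connected-sym (inj₂ (_ , _ , u∈e , e⋯f , v∈f)) =
    inj₂ (_ , _ , v∈f , reverse (λ (w , w∈e , w∈f) → w , w∈f , w∈e) e⋯f , u∈e)

  Connected-trans : Transitive Connected
  Connected-trans (inj₁ refl) q = q
  Connected-trans p@(inj₂ _) (inj₁ refl) = p
  Connected-trans (inj₂ (_ , _ , u∈e , e⋯f , v∈f)) (inj₂ (_ , _ , v∈g , g⋯h , w∈h)) =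
    inj₂ (_ , _ , u∈e , e⋯f ◅◅ ((_ , v∈f , v∈g) ◅ g⋯h) , w∈h)

  -- A representative of the component to be taken in one color. The fields are conditional, so if
  -- no pair is connected, any vertex will do. A link to one end of a connected pair is enough, by
  -- transitivity.
  record Majority (x y z : Vertex) : Set where
    field
      vertex : Vertex
      from-x≈y : Connected x y → Connected vertex x
      from-x≈z : Connected x z → Connected vertex x
      from-y≈z : Connected y z → Connected vertex y

  -- If `x` is connected to `y` or `z`, then `x` serves. Otherwise only `y` and `z` can be
  -- connected, and `y` serves.
  majority : ∀ x y z → Majority x y z
  majority x y z with connected? x y | connected? x z
  ... | yes x≈y | _ = record
    { vertex = x ; from-x≈y = const (inj₁ refl) ; from-x≈z = const (inj₁ refl)
    ; from-y≈z = const x≈y }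
  ... | no _ | yes x≈z = record
    { vertex = x ; from-x≈y = const (inj₁ refl) ; from-x≈z = const (inj₁ refl)
    ; from-y≈z = λ y≈z → Connected-trans x≈z (Connected-sym y≈z) }
  ... | no x≉y | no x≉z = record
    { vertex = y
    ; from-x≈y = λ x≈y → contradiction x≈y x≉y
    ; from-x≈z = λ x≈z → contradiction x≈z x≉z
    ; from-y≈z = const (inj₁ refl) }

module _ {A : Set} {P : A → Set} where

  replace : ∀ {n} {xs : Vec A n} → All P xs → ∀ i → P (Vec.lookup xs i) → All P xs
  replace (_ ∷ ps) zero    q = q ∷ ps
  replace (p ∷ ps) (suc i) q = p ∷ replace ps i q

  lookup⁺-replace : ∀ {n} {xs : Vec A n} (ps : All P xs) i (q : P (Vec.lookup xs i)) →
                    lookup⁺ (replace ps i q) i ≡ q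
  lookup⁺-replace (_ ∷ _)  zero    q = refl
  lookup⁺-replace (_ ∷ ps) (suc i) q = lookup⁺-replace ps i q

nonZero⇒Fin : ∀ {n} → NonZero n → Fin n
nonZero⇒Fin {suc _} _ = zero

coverableBy-colors : ∀ {n k} (sizes : Vec ℕ (suc (suc (suc n)))) → All NonZero sizes →
                     (χ : Coloring (completePartite sizes) k) →
                     CoverableBy (completePartite sizes) χ k
-- Splitting `nonEmpty` lets `base` and `replace` compute, so in `covered` the two fixed vertices
-- lie on the modified edge by `refl`.
coverableBy-colors {k = k} sizes nonEmpty@(_ ∷ _ ∷ _ ∷ _) χ =
  Vec.tabulate component , covered
  where
  K = completePartite sizes
  open Hypergraph K using (Vertex; Edge; _∈_)

  base : Edge
  base = All.map nonZero⇒Fin nonEmpty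

  x y z : Vertex
  x = zero           , lookup⁺ base zero
  y = suc zero       , lookup⁺ base (suc zero)
  z = suc (suc zero) , lookup⁺ base (suc (suc zero))

  majorityOf : ∀ i → Majority (colorClass K χ i) x y z
  majorityOf i = majority (colorClass K χ i) x y z

  component : Fin k → MonochromaticComponent K χ
  component i = i , Majority.vertex (majorityOf i)

  -- In its own color, `e` connects `p` to both `q` and `v`. Here `p` and `q` are two of the fixed
  -- vertices, and `joined` is their field of `Majority`.
  coveredThrough : ∀ e {v p q} → v ∈ e → p ∈ e → q ∈ e →
    (let Kᵢ = colorClass K χ (χ e) in
     Hypergraph.Connected Kᵢ p q →
     Hypergraph.Connected Kᵢ (Majority.vertex (majorityOf (χ e))) p) →
    Any (_∈ᶜ_ K χ v) (Vec.tabulate component)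
  coveredThrough e {v} {p} {q} v∈e p∈e q∈e joined = tabulate⁺ {f = component} (χ e)
    (Connected-trans Kᵢ (joined (commonEdge⇒Connected Kᵢ {p} {q} {e , refl} p∈e q∈e))
                        (commonEdge⇒Connected Kᵢ {p} {v} {e , refl} p∈e v∈e))
    where Kᵢ = colorClass K χ (χ e)

  covered : ∀ v → Any (_∈ᶜ_ K χ v) (Vec.tabulate component)
  covered (j@zero , a) =
    coveredThrough (replace base j a) (lookup⁺-replace base j a) refl refl
      (Majority.from-y≈z (majorityOf _))
  covered (j@(suc zero) , a) =
    coveredThrough (replace base j a) (lookup⁺-replace base j a) refl refl
      (Majority.from-x≈z (majorityOf _))
  -- This covers the third class and all later ones: `x` and `y` lie outside each of them.
  covered (j@(suc (suc _)) , a) =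
    coveredThrough (replace base j a) (lookup⁺-replace base j a) refl refl
      (Majority.from-x≈y (majorityOf _))

module _ (n k : ℕ) where

  private
    K = completePartite (replicate (suc n) k)
    open Hypergraph K using (Vertex)

  headColoring : Coloring K k
  headColoring = All.head

  firstClass : Fin k → Vertex
  firstClass a = zero , a

  -- The first and last edges of a connecting sequence have color `i`, so both have `i` as their
  -- vertex in the first class, giving `a = i = b`.
  firstClass-disconnected : ∀ i {a b} →
    Hypergraph.Connected (colorClass K headColoring i) (firstClass a) (firstClass b) → a ≡ b
  firstClass-disconnected i (inj₁ refl) = refl
  firstClass-disconnected i (inj₂ ((_ ∷ _ , refl) , (_ ∷ _ , refl) , refl , _ , refl)) = refl

  -- Pigeonhole: two vertices of the first class covered at the same position of `Cs` would share a
  -- component.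
  coverableBy⇒colors≤ : ∀ {m} → CoverableBy K headColoring m → k ≤ m
  coverableBy⇒colors≤ (Cs , covered) = injective⇒≤ {f = position} position-injective
    where
    position : Fin k → Fin _
    position a = index (covered (firstClass a))

    lies : ∀ a → _∈ᶜ_ K headColoring (firstClass a) (Vec.lookup Cs (position a))
    lies a = lookup-index (covered (firstClass a))

    position-injective : ∀ {a b} → position a ≡ position b → a ≡ b
    position-injective {a} {b} eq = firstClass-disconnected i
      (Connected-trans Kᵢ (Connected-sym Kᵢ (lies a))
        (subst (λ l → _∈ᶜ_ K headColoring (firstClass b) (Vec.lookup Cs l)) (sym eq) (lies b)))
      where
      i = proj₁ (Vec.lookup Cs (position a))
      Kᵢ = colorClass K headColoring i

All-replicate : ∀ {A : Set} {P : A → Set} {x} n → P x → All P (replicate n x)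
All-replicate zero    p = []
All-replicate (suc n) p = p ∷ All-replicate n p

theorem1p1 : (r k : ℕ) .{{_ : NonZero k}} → 3 ≤ r → COV≡ r k k
-- From here on, `r` counts the classes other than the first.
theorem1p1 (suc r@(suc (suc _))) k@(suc _) (s≤s (s≤s (s≤s _))) =
  (sizes , nonEmpty , χ ,
    ≤-antisym (c≤k sizes nonEmpty χ) (coverableBy⇒colors≤ r k coverableBy-c)) ,
  λ { _ (sizes , nonEmpty , χ , refl) → c≤k sizes nonEmpty χ }
  where
  sizes = replicate (suc r) k
  nonEmpty = All-replicate (suc r) _
  χ = headColoring r k

  coverableBy-c : CoverableBy (completePartite sizes) χ (c (completePartite sizes) χ)
  coverableBy-c = proj₁ (proj₂ (minimumCover (completePartite sizes) χ))

  c≤k : ∀ sizes → All NonZero sizes → (χ : Coloring (completePartite sizes) k) →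
        c (completePartite sizes) χ ≤ k
  c≤k sizes nonEmpty χ =
    proj₂ (proj₂ (minimumCover (completePartite sizes) χ)) k
      (coverableBy-colors sizes nonEmpty χ)
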